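{- Let $n$ be a positive integer. There exists a form $F\in\mathbb{Z}[x_1,\ldots,x_n]$ (a polynomial $F\in\mathbb{Z}[x]$ if $n=1$), a prime number $p$, and $M>0$ such that $R(F)$ is dense in $\mathbb{Q}_p$, but $R(F)$ is not dense in $\mathbb{Q}_q$ for every prime $q>M$.
   Context: For $F\in\mathbb{Z}[x_1,\dots,x_n]$, $R(F)=\{F(\overline{x})/F(\overline{y}) : \overline{x},\overline{y}\in\mathbb{Z}^n,\ F(\overline{y})\neq 0\}$, and density is with respect to the $p$-adic (resp. $q$-adic) topology. -}

module Defs where

open import Level using (0ℓ)
open import Data.Nat.Base as ℕ using (ℕ)
import Data.Nat.Properties as ℕ
open import Data.Nat.Divisibility using (_∣_; _∤_)
open import Data.Integer.Base as ℤ using (ℤ; 0ℤ; 1ℤ)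
open import Data.Rational.Base as ℚ using (ℚ; ↥_; ↧ₙ_; _-_; _÷_)
open import Data.Rational.Literals using (fromℤ)
open import Data.List.Base as List using (List)
open import Data.Vec.Base as Vec using (Vec)
open import Data.Vec.Properties using (≡-dec)
open import Data.Product.Base using (_×_; proj₁; proj₂; Σ-syntax; ∃-syntax)
open import Relation.Binary.PropositionalEquality.Core using (_≡_; _≢_)
open import Relation.Unary using (Pred)

-- ℤ[x₁,…,xₙ], presented as finite sums of terms c · x₁^e₁ ⋯ xₙ^eₙ.
-- The same exponent vector may occur several times, so the coefficient of a
-- monomial is obtained by collecting terms; homogeneity is stated through
-- these collected coefficients and so does not depend on the presentation.

Term : ℕ → Set
Term n = ℤ × Vec ℕ n

Poly : ℕ → Set
Poly n = List (Term n)

∑ : List ℤ → ℤ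
∑ = List.foldr ℤ._+_ 0ℤ

coeff : ∀ {n} → Poly n → Vec ℕ n → ℤ
coeff F e = ∑ (List.map proj₁ (List.filter (λ t → ≡-dec ℕ._≟_ (proj₂ t) e) F))

evalTerm : ∀ {n} → Term n → Vec ℤ n → ℤ
evalTerm t x = proj₁ t ℤ.* Vec.foldr′ ℤ._*_ 1ℤ (Vec.zipWith ℤ._^_ x (proj₂ t))

eval : ∀ {n} → Poly n → Vec ℤ n → ℤ
eval F x = ∑ (List.map (λ t → evalTerm t x) F)

IsHomogeneous : ∀ {n} → ℕ → Poly n → Set
IsHomogeneous d F = ∀ e → coeff F e ≢ 0ℤ → Vec.sum e ≡ d

IsForm : ∀ {n} → Poly n → Set
IsForm F = ∃[ d ] IsHomogeneous d F

R : ∀ {n} → Poly n → Pred ℚ 0ℓ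
R {n} F r =
  Σ[ x ∈ Vec ℤ n ] Σ[ y ∈ Vec ℤ n ] Σ[ Fy≢0 ∈ eval F y ≢ 0ℤ ]
    r ≡ (fromℤ (eval F x) ÷ fromℤ (eval F y)) {{ℤ.≢-nonZero Fy≢0}}

-- For p prime, ∣ r ∣[ p ]≤p^- k says |r|ₚ ≤ p^(-k).  As r is in lowest terms
-- and k is a natural number, this means that p^k divides the numerator and
-- p does not divide the denominator.

∣_∣[_]≤p^-_ : ℚ → ℕ → ℕ → Set
∣ r ∣[ p ]≤p^- k = (p ℕ.^ k) ∣ ℤ.∣ ↥ r ∣ × p ∤ ↧ₙ r

-- ℚₚ as the completion of ℚ: its elements are represented by p-adic Cauchy
-- sequences.  No equality on ℚₚ is needed, because the balls below do not
-- distinguish sequences whose difference tends to 0.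

record ℚₚ (p : ℕ) : Set where
  field
    seq    : ℕ → ℚ
    cauchy : ∀ k → ∃[ N ] (∀ i j → N ℕ.≤ i → N ℕ.≤ j →
               ∣ seq i - seq j ∣[ p ]≤p^- k)

open ℚₚ public

-- |α - r|ₚ ≤ p^(-k).  The values |seq α i - r|ₚ converge to |α - r|ₚ and
-- p^(-k) is isolated among the possible values other than 0, so the
-- inequality holds exactly when it holds for all large i.

InBall : ∀ {p} → ℚₚ p → ℕ → Pred ℚ 0ℓ
InBall {p} α k r = ∃[ N ] (∀ i → N ℕ.≤ i → ∣ seq α i - r ∣[ p ]≤p^- k)

DenseInℚₚ : ℕ → Pred ℚ 0ℓ → Set
DenseInℚₚ p S = ∀ (α : ℚₚ p) (k : ℕ) → ∃[ r ] (S r × InBall α k r)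

{-# OPTIONS --safe #-}

-- F is a product of powers of pairwise non-proportional linear forms in two
-- variables (the second being 1 when n = 1).  All exponents are multiples of 15,
-- 21 or 35, and the degree is a multiple of 105.  If q exceeds all 2 × 2
-- determinants of the linear forms, then q divides at most one of them at a
-- primitive point, so every v_q(F(x)) is a multiple of 15, 21 or 35.  Any two of
-- these numbers have a common factor, so no ratio has q-adic valuation 1.
--
-- For p = 2 every odd number is a 15th power modulo 2^K, so F takes values with
-- any odd part and valuation 15i + 21 near its root -1 of multiplicity 15.  Near
-- the roots 1, 2 and 4, of multiplicity 21, the valuations are 21e + 15, 21e + 56
-- and 21e + 91.  The constants cover all residues modulo 3 = gcd(15, 21), so the
-- ratios approximate every fraction.

module Submission where

open import Defs
open import Data.Nat.Base as ℕ using (ℕ; zero; suc; _≤_; _<_; z≤n; s≤s)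
import Data.Nat.Coprimality as ℕ
import Data.Nat.Divisibility as ℕ
open import Data.Nat.Primality using (Prime; euclidsLemma; prime[2]; prime⇒nonZero; prime⇒nonTrivial; ¬prime[1])
import Data.Nat.Properties as ℕ
import Data.Nat.Tactic.RingSolver as ℕ-Solver
open import Data.Integer.Base using (ℤ; +_; 0ℤ; 1ℤ; -1ℤ; _+_; _*_; _-_; -_; _^_; ≢-nonZero)
import Data.Integer.Base as ℤ
open import Data.Integer.Divisibility.Signed
  using (_∣_; divides; _∣?_; ∣ᵤ⇒∣; ∣⇒∣ᵤ; ∣m∣n⇒∣m+n; ∣m∣n⇒∣m-n; ∣m+n∣m⇒∣n; ∣n⇒∣m*n; ∣m⇒∣m*n; ∣-refl; ∣-trans; *-monoʳ-∣)
import Data.Integer.DivMod as ℤ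
import Data.Integer.GCD as ℤ
import Data.Integer.Properties as ℤ
open import Data.Integer.Tactic.RingSolver using (solve-∀)
open import Data.List.Base using (List; []; _∷_; _++_; map; cartesianProductWith; take; drop)
open import Data.List.Relation.Unary.All as All using (All; []; _∷_; all?)
import Data.List.Relation.Unary.All.Properties as All
open import Data.List.Relation.Unary.AllPairs as AllPairs using (AllPairs; []; _∷_; allPairs?)
open import Data.Product.Base using (_×_; _,_; proj₁; proj₂; ∃-syntax; Σ-syntax)
open import Data.Rational.Base as ℚ using (ℚ; mkℚ; ↥_; ↧_; ↧ₙ_)
open import Data.Rational.Literals using (fromℤ)
import Data.Rational.Properties as ℚ
open import Data.Sum.Base as Sum using (_⊎_; inj₁; inj₂; [_,_]′)
open import Data.Vec.Base as Vec using (Vec; []; _∷_)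
open import Data.Vec.Properties using (≡-dec)
open import Relation.Binary.PropositionalEquality
open import Relation.Nullary.Decidable using (Dec; yes; no; from-no; from-yes; _×-dec_; _⊎-dec_)
open import Relation.Nullary.Negation.Core using (¬_; contradiction)
open ≡-Reasoning

-- Valuations of integers at a prime

record Val (p : ℕ) (x : ℤ) (v : ℕ) : Set where
  constructor val
  field
    unit          : ℤ
    factorisation : x ≡ (+ p) ^ v * unit
    p∤unit        : ¬ (+ p ∣ unit)

*-interchange : ∀ a b c d → (a * b) * (c * d) ≡ (a * c) * (b * d)
*-interchange = solve-∀

module _ {p : ℕ} (pp : Prime p) where

  private
    instance
      p≢0 : ℕ.NonZero p
      p≢0 = prime⇒nonZero pp

      +p≢0 : ℤ.NonZero (+ p)
      +p≢0 = p≢0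

  euclidsLemmaℤ : ∀ x y → + p ∣ x * y → + p ∣ x ⊎ + p ∣ y
  euclidsLemmaℤ x y p∣xy = Sum.map ∣ᵤ⇒∣ ∣ᵤ⇒∣
    (euclidsLemma ℤ.∣ x ∣ ℤ.∣ y ∣ pp (subst (p ℕ.∣_) (ℤ.abs-* x y) (∣⇒∣ᵤ p∣xy)))

  ∤1 : ¬ (+ p ∣ 1ℤ)
  ∤1 p∣1 = ¬prime[1] (subst Prime (ℕ.∣1⇒≡1 (∣⇒∣ᵤ p∣1)) pp)

  ^≢0 : ∀ v → (+ p) ^ v ≢ 0ℤ
  ^≢0 v eq = ℕ.≢-nonZero⁻¹ p (ℤ.+-injective (ℤ.i^n≡0⇒i≡0 (+ p) v eq))

  ^-cancelˡ : ∀ v {x y} → (+ p) ^ v * x ≡ (+ p) ^ v * y → x ≡ y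
  ^-cancelˡ v {x} {y} = ℤ.*-cancelˡ-≡ ((+ p) ^ v) x y {{≢-nonZero (^≢0 v)}}

  val-unit : ∀ {x} → ¬ (+ p ∣ x) → Val p x 0
  val-unit {x} p∤x = val x (sym (ℤ.*-identityˡ x)) p∤x

  val-1 : Val p 1ℤ 0
  val-1 = val-unit ∤1

  val-* : ∀ {x y v w} → Val p x v → Val p y w → Val p (x * y) (v ℕ.+ w)
  val-* {v = v} {w} (val c refl p∤c) (val d refl p∤d) =
    val (c * d)
      (trans (*-interchange ((+ p) ^ v) c ((+ p) ^ w) d)
             (cong (_* (c * d)) (sym (ℤ.^-distribˡ-+-* (+ p) v w))))
      (λ p∣cd → [ p∤c , p∤d ]′ (euclidsLemmaℤ c d p∣cd))

  val-^ : ∀ {x v} → Val p x v → ∀ m → Val p (x ^ m) (m ℕ.* v)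
  val-^ vx zero    = val-1
  val-^ vx (suc m) = val-* vx (val-^ vx m)

  val-p^ : ∀ v → Val p ((+ p) ^ v) v
  val-p^ v = val 1ℤ (sym (ℤ.*-identityʳ _)) ∤1

  val-p : Val p (+ p) 1
  val-p = subst (λ x → Val p x 1) (ℤ.*-identityʳ (+ p)) (val-p^ 1)

  val⇒≢0 : ∀ {x v} → Val p x v → x ≢ 0ℤ
  val⇒≢0 {v = v} (val c eq p∤c) refl =
    [ ^≢0 v , (λ c≡0 → p∤c (subst (+ p ∣_) (sym c≡0) (divides 0ℤ refl))) ]′
      (ℤ.i*j≡0⇒i≡0∨j≡0 ((+ p) ^ v) (sym eq))

  -- Dividing by `p` strictly lowers the absolute value of a nonzero integer, so the recursion runs
  -- on a bound for it.
  val-exists : ∀ {x} → x ≢ 0ℤ → ∃[ v ] Val p x v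
  val-exists {x} = go ℤ.∣ x ∣ x ℕ.≤-refl
    where
    go : ∀ n x → ℤ.∣ x ∣ ≤ n → x ≢ 0ℤ → ∃[ v ] Val p x v
    go zero    x ∣x∣≤0 x≢0 = contradiction (ℤ.∣i∣≡0⇒i≡0 (ℕ.n≤0⇒n≡0 ∣x∣≤0)) x≢0
    go (suc n) x ∣x∣≤n x≢0 with + p ∣? x
    ... | no  p∤x = 0 , val-unit p∤x
    ... | yes (divides q refl) = extend (go n q (ℕ.≤-pred (ℕ.<-≤-trans ∣q∣<∣x∣ ∣x∣≤n)) q≢0)
      where
      q≢0 : q ≢ 0ℤ
      q≢0 refl = x≢0 refl

      1<p : 1 < p
      1<p = ℕ.nonTrivial⇒n>1 p {{prime⇒nonTrivial pp}}

      ∣q∣<∣x∣ : ℤ.∣ q ∣ < ℤ.∣ q * + p ∣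
      ∣q∣<∣x∣ = subst (ℤ.∣ q ∣ <_) (sym (ℤ.abs-* q (+ p)))
        (ℕ.m<m*n ℤ.∣ q ∣ p {{≢-nonZero q≢0}} 1<p)

      extend : ∃[ v ] Val p q v → ∃[ v ] Val p (q * + p) v
      extend (v , vq) = v ℕ.+ 1 , val-* vq val-p

  -- Powers of `p` are cancelled from both factorisations together; if one side runs out first, `p`
  -- divides its unit.
  val-unique : ∀ {x v w} → Val p x v → Val p x w → v ≡ w
  val-unique (val c refl p∤c) (val d eq p∤d) = go _ _ eq p∤c p∤d
    where
    p∣p^* : ∀ v x → + p ∣ (+ p) ^ suc v * x
    p∣p^* v x = ∣m⇒∣m*n x (∣m⇒∣m*n ((+ p) ^ v) ∣-refl)

    go : ∀ v w {c d} → (+ p) ^ v * c ≡ (+ p) ^ w * d → ¬ (+ p ∣ c) → ¬ (+ p ∣ d) → v ≡ w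
    go zero    zero    eq p∤c p∤d = refl
    go zero    (suc w) eq p∤c p∤d =
      contradiction (subst (+ p ∣_) (trans (sym eq) (ℤ.*-identityˡ _)) (p∣p^* w _)) p∤c
    go (suc v) zero    eq p∤c p∤d =
      contradiction (subst (+ p ∣_) (trans eq (ℤ.*-identityˡ _)) (p∣p^* v _)) p∤d
    go (suc v) (suc w) {c} {d} eq p∤c p∤d = cong suc (go v w
      (ℤ.*-cancelˡ-≡ (+ p) _ _
        (trans (sym (ℤ.*-assoc (+ p) ((+ p) ^ v) c)) (trans eq (ℤ.*-assoc (+ p) ((+ p) ^ w) d))))
      p∤c p∤d)

  -- If x = p^v c, the perturbation changes the cofactor c only by a multiple of p. This carries
  -- valuations from a root over to nearby points.
  val-near : ∀ {x y v} → Val p x v → (+ p) ^ suc v ∣ y - x → Val p y v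
  val-near {y = y} {v} (val c refl p∤c) (divides q eq) =
    val (c + q * + p) (trans (sub y _) (trans (cong (_+ (+ p) ^ v * c) eq) (collect q (+ p) ((+ p) ^ v) c)))
      (λ d → p∤c (∣m+n∣m⇒∣n (subst (+ p ∣_) (ℤ.+-comm c (q * + p)) d) (divides q refl)))
    where
    sub : ∀ y x → y ≡ (y - x) + x
    sub = solve-∀
    collect : ∀ q p P c → q * (p * P) + P * c ≡ P * (c + q * p)
    collect = solve-∀

  ^∣*⇒^∣ : ∀ k x {y} → ¬ (+ p ∣ y) → (+ p) ^ k ∣ x * y → (+ p) ^ k ∣ x
  ^∣*⇒^∣ zero    x     p∤y d = divides x (sym (ℤ.*-identityʳ x))
  ^∣*⇒^∣ (suc k) x {y} p∤y d with euclidsLemmaℤ x y (∣-trans (∣m⇒∣m*n ((+ p) ^ k) ∣-refl) d)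
  ... | inj₂ p∣y = contradiction p∣y p∤y
  ... | inj₁ (divides q refl) with d
  ...   | divides r eq = subst ((+ p) ^ suc k ∣_) (ℤ.*-comm (+ p) q)
      (*-monoʳ-∣ (+ p) (^∣*⇒^∣ k q p∤y (divides r
        (ℤ.*-cancelˡ-≡ (+ p) _ _ (trans (left (+ p) q y) (trans eq (right (+ p) r ((+ p) ^ k))))))))
    where
    left : ∀ p q y → p * (q * y) ≡ q * p * y
    left = solve-∀
    right : ∀ p r P → r * (p * P) ≡ p * (r * P)
    right = solve-∀

  abs-p^ : ∀ k → ℤ.∣ (+ p) ^ k ∣ ≡ p ℕ.^ k
  abs-p^ zero    = refl
  abs-p^ (suc k) = trans (ℤ.abs-* (+ p) ((+ p) ^ k)) (cong (p ℕ.*_) (abs-p^ k))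

  ¬∣↥×∣↧ : ∀ t → + p ∣ ↥ t → ¬ (+ p ∣ ↧ t)
  ¬∣↥×∣↧ (mkℚ n d-1 n⊥d) p∣n p∣d =
    -- The coprimality proof `n⊥d` is an irrelevant field of `mkℚ`; being decidable, coprimality can
    -- be recomputed.
    ¬prime[1] (subst Prime (ℕ.recompute n⊥d (∣⇒∣ᵤ p∣n , ∣⇒∣ᵤ p∣d)) pp)

  -- The size of `t` is read off any fraction a / b equal to it, reduced or not. Cancelling p^v
  -- leaves an equation with a unit in place of b, so p^k passes to the numerator, and a factor p of
  -- the denominator would divide the numerator as well.
  fraction-small : ∀ t {a b v} k → ↥ t * b ≡ a * ↧ t → Val p b v →
                   (+ p) ^ (v ℕ.+ k) ∣ a → ∣ t ∣[ p ]≤p^- k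
  fraction-small t {v = v} k eq (val b refl p∤b) (divides q refl) =
      subst (ℕ._∣ ℤ.∣ ↥ t ∣) (abs-p^ k) (∣⇒∣ᵤ (^∣*⇒^∣ k (↥ t) p∤b (divides (q * ↧ t) reduced)))
    , λ p∣d → let p∣↧ = ∣ᵤ⇒∣ {+ p} {↧ t} p∣d in
        [ (λ p∣n → ¬∣↥×∣↧ t p∣n p∣↧) , p∤b ]′
          (euclidsLemmaℤ (↥ t) b (subst (+ p ∣_) (sym reduced) (∣m⇒∣m*n ((+ p) ^ k) (∣n⇒∣m*n q p∣↧))))
    where
    left : ∀ P t b → P * (t * b) ≡ t * (P * b)
    left = solve-∀
    right : ∀ q P K d → q * (P * K) * d ≡ P * (q * d * K)
    right = solve-∀
    reduced : ↥ t * b ≡ q * ↧ t * (+ p) ^ k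
    reduced = ^-cancelˡ v (begin
      (+ p) ^ v * (↥ t * b)               ≡⟨ left ((+ p) ^ v) (↥ t) b ⟩
      ↥ t * ((+ p) ^ v * b)               ≡⟨ eq ⟩
      q * (+ p) ^ (v ℕ.+ k) * ↧ t         ≡⟨ cong (λ P → q * P * ↧ t) (ℤ.^-distribˡ-+-* (+ p) v k) ⟩
      q * ((+ p) ^ v * (+ p) ^ k) * ↧ t   ≡⟨ right q ((+ p) ^ v) ((+ p) ^ k) (↧ t) ⟩
      (+ p) ^ v * (q * ↧ t * (+ p) ^ k)   ∎)

-- Numerators and denominators of sums, differences and quotients

*-cross : ∀ N D {n d} z → N * z ≡ n → D * z ≡ d → N * d ≡ n * D
*-cross N D z refl refl = swap N D z
  where
  swap : ∀ N D z → N * (D * z) ≡ N * z * D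
  swap = solve-∀

-- `ℚ.↥-+` and `ℚ.↧-+` describe the reduced fraction only up to a common gcd, which drops out on
-- cross-multiplication.
↥-+-cross : ∀ s t → ↥ (s ℚ.+ t) * (↧ s * ↧ t) ≡ (↥ s * ↧ t + ↥ t * ↧ s) * ↧ (s ℚ.+ t)
↥-+-cross s t = *-cross (↥ (s ℚ.+ t)) (↧ (s ℚ.+ t)) (ℤ.gcd (↥ s * ↧ t + ↥ t * ↧ s) (↧ s * ↧ t)) (ℚ.↥-+ s t) (ℚ.↧-+ s t)

↥-‿-cross : ∀ s t → ↥ (s ℚ.- t) * (↧ s * ↧ t) ≡ (↥ s * ↧ t - ↥ t * ↧ s) * ↧ (s ℚ.- t)
↥-‿-cross s t = begin
  ↥ (s ℚ.- t) * (↧ s * ↧ t)                                ≡⟨ cong (λ d → ↥ (s ℚ.- t) * (↧ s * d)) (ℚ.↧-neg t) ⟨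
  ↥ (s ℚ.- t) * (↧ s * ↧ (ℚ.- t))                          ≡⟨ ↥-+-cross s (ℚ.- t) ⟩
  (↥ s * ↧ (ℚ.- t) + ↥ (ℚ.- t) * ↧ s) * ↧ (s ℚ.- t)        ≡⟨ cong₂ (λ d n → (↥ s * d + n * ↧ s) * ↧ (s ℚ.- t)) (ℚ.↧-neg t) (ℚ.↥-neg t) ⟩
  (↥ s * ↧ t + (- ↥ t) * ↧ s) * ↧ (s ℚ.- t)                ≡⟨ cong (λ z → (↥ s * ↧ t + z) * ↧ (s ℚ.- t)) (ℤ.neg-distribˡ-* (↥ t) (↧ s)) ⟨
  (↥ s * ↧ t - ↥ t * ↧ s) * ↧ (s ℚ.- t)                    ∎

÷-cross : ∀ {r} a b .{{_ : ℤ.NonZero b}} → r ≡ fromℤ a ℚ.÷ fromℤ b → ↥ r * b ≡ a * ↧ r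
÷-cross {r} a b {{b≢0}} refl = begin
  ↥ r * b                       ≡⟨ ℤ.*-identityʳ (↥ r * b) ⟨
  ↥ r * b * 1ℤ                  ≡⟨ cong (λ t → ↥ r * b * ↧ t) rb≡a ⟨
  ↥ r * b * ↧ (r ℚ.* fromℤ b)   ≡⟨ *-cross (↥ (r ℚ.* fromℤ b)) (↧ (r ℚ.* fromℤ b)) (ℤ.gcd (↥ r * b) (↧ r * 1ℤ)) (ℚ.↥-* r (fromℤ b)) (ℚ.↧-* r (fromℤ b)) ⟨
  ↥ (r ℚ.* fromℤ b) * (↧ r * 1ℤ) ≡⟨ cong₂ (λ t d → ↥ t * d) rb≡a (ℤ.*-identityʳ (↧ r)) ⟩
  a * ↧ r                       ∎
  where
  rb≡a : r ℚ.* fromℤ b ≡ fromℤ a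
  rb≡a = trans (ℚ.*-assoc (fromℤ a) ((ℚ.1/ fromℤ b) {{b≢0}}) (fromℤ b))
    (trans (cong (fromℤ a ℚ.*_) (ℚ.*-inverseˡ (fromℤ b) {{b≢0}})) (ℚ.*-identityʳ (fromℤ a)))

-- Rationals that are p-adically small

module _ {p : ℕ} (pp : Prime p) where

  ∤↧ₙ⇒∤↧ : ∀ t → p ℕ.∤ ↧ₙ t → ¬ (+ p ∣ ↧ t)
  ∤↧ₙ⇒∤↧ t p∤d p∣d = p∤d (∣⇒∣ᵤ p∣d)

  ^∣↥ : ∀ t k → p ℕ.^ k ℕ.∣ ℤ.∣ ↥ t ∣ → (+ p) ^ k ∣ ↥ t
  ^∣↥ t k d = ∣ᵤ⇒∣ (subst (ℕ._∣ ℤ.∣ ↥ t ∣) (sym (abs-p^ pp k)) d)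

  small-+ : ∀ {s t k} → ∣ s ∣[ p ]≤p^- k → ∣ t ∣[ p ]≤p^- k → ∣ s ℚ.+ t ∣[ p ]≤p^- k
  small-+ {s} {t} {k} (p^∣s , p∤s) (p^∣t , p∤t) =
    fraction-small pp (s ℚ.+ t) k (↥-+-cross s t)
      (val-* pp (val-unit pp (∤↧ₙ⇒∤↧ s p∤s)) (val-unit pp (∤↧ₙ⇒∤↧ t p∤t)))
      (∣m∣n⇒∣m+n (∣m⇒∣m*n (↧ t) (^∣↥ s k p^∣s)) (∣m⇒∣m*n (↧ s) (^∣↥ t k p^∣t)))

  -- The conclusion says v_p(a) = v_p(b) + 1 in a form that does not presuppose a ≢ 0.
  near-p : ∀ r {a b} → ↥ r * b ≡ a * ↧ r → ∣ fromℤ (+ p) ℚ.- r ∣[ p ]≤p^- 2 →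
           ∃[ d ] ∃[ e ] (¬ (+ p ∣ d) × ¬ (+ p ∣ e) × a * d ≡ + p * (b * e))
  near-p r {a} {b} cross (p²∣t , p∤t) with ^∣↥ (fromℤ (+ p) ℚ.- r) 2 p²∣t
  -- From p - r = m p² / D follows r = p (D - m p) / D, which gives both witnesses.
  ... | divides m eq = D , D - m * + p , p∤D , p∤e , ℤ.*-cancelʳ-≡ _ _ (↧ r) (begin
    a * D * ↧ r                                      ≡⟨ s₁ a D (↧ r) ⟩
    a * ↧ r * D                                      ≡⟨ cong (_* D) cross ⟨
    ↥ r * b * D                                      ≡⟨ s₂ (+ p) (↥ r) (↧ r) b D ⟩
    b * (+ p * ↧ r * D - (+ p * ↧ r - ↥ r * 1ℤ) * D) ≡⟨ cong (λ z → b * (+ p * ↧ r * D - z)) (↥-‿-cross (fromℤ (+ p)) r) ⟨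
    b * (+ p * ↧ r * D - N * (1ℤ * ↧ r))             ≡⟨ cong (λ z → b * (+ p * ↧ r * D - z * (1ℤ * ↧ r))) eq ⟩
    b * (+ p * ↧ r * D - m * (+ p * (+ p * 1ℤ)) * (1ℤ * ↧ r)) ≡⟨ s₃ b (+ p) (↧ r) D m ⟩
    + p * (b * (D - m * + p)) * ↧ r                  ∎)
    where
    N = ↥ (fromℤ (+ p) ℚ.- r)
    D = ↧ (fromℤ (+ p) ℚ.- r)
    p∤D : ¬ (+ p ∣ D)
    p∤D = ∤↧ₙ⇒∤↧ (fromℤ (+ p) ℚ.- r) p∤t
    split : ∀ D z → (D - z) + z ≡ D
    split = solve-∀
    p∤e : ¬ (+ p ∣ D - m * + p)
    p∤e p∣e = p∤D (subst (+ p ∣_) (split D (m * + p)) (∣m∣n⇒∣m+n p∣e (divides m refl)))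
    s₁ : ∀ a D r → a * D * r ≡ a * r * D
    s₁ = solve-∀
    s₂ : ∀ p n d b D → n * b * D ≡ b * (p * d * D - (p * d - n * 1ℤ) * D)
    s₂ = solve-∀
    s₃ : ∀ b p d D m → b * (p * d * D - m * (p * (p * 1ℤ)) * (1ℤ * d)) ≡ p * (b * (D - m * p)) * d
    s₃ = solve-∀

-- Products of powers of binary linear forms

infix 6 _X+_Y^_

record LinearPower : Set where
  constructor _X+_Y^_
  field
    a b : ℤ
    m   : ℕ

open LinearPower

linear : LinearPower → ℤ → ℤ → ℤ
linear f x y = a f * x + b f * y

⟦_⟧ : List LinearPower → ℤ → ℤ → ℤ
⟦ []    ⟧ x y = 1ℤ
⟦ f ∷ L ⟧ x y = linear f x y ^ m f * ⟦ L ⟧ x y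

degree : List LinearPower → ℕ
degree []      = 0
degree (f ∷ L) = m f ℕ.+ degree L

det : LinearPower → LinearPower → ℤ
det f g = a f * b g - a g * b f

^-distribʳ-* : ∀ x y n → (x * y) ^ n ≡ x ^ n * y ^ n
^-distribʳ-* x y zero    = refl
^-distribʳ-* x y (suc n) =
  trans (cong (x * y *_) (^-distribʳ-* x y n)) (*-interchange x y (x ^ n) (y ^ n))

-- Pulls the gcd of the coordinates out of a value, which reduces valuations to primitive points.
⟦⟧-scale : ∀ L x y g → ⟦ L ⟧ (x * g) (y * g) ≡ ⟦ L ⟧ x y * g ^ degree L
⟦⟧-scale []      x y g = refl
⟦⟧-scale (f ∷ L) x y g = begin
  (a f * (x * g) + b f * (y * g)) ^ m f * ⟦ L ⟧ (x * g) (y * g)    ≡⟨ cong₂ _*_ (cong (_^ m f) (factor (a f) (b f) x y g)) (⟦⟧-scale L x y g) ⟩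
  (linear f x y * g) ^ m f * (⟦ L ⟧ x y * g ^ degree L)            ≡⟨ cong (_* (⟦ L ⟧ x y * g ^ degree L)) (^-distribʳ-* (linear f x y) g (m f)) ⟩
  linear f x y ^ m f * g ^ m f * (⟦ L ⟧ x y * g ^ degree L)        ≡⟨ *-interchange (linear f x y ^ m f) _ _ _ ⟩
  ⟦ f ∷ L ⟧ x y * (g ^ m f * g ^ degree L)                         ≡⟨ cong (⟦ f ∷ L ⟧ x y *_) (ℤ.^-distribˡ-+-* g (m f) (degree L)) ⟨
  ⟦ f ∷ L ⟧ x y * g ^ degree (f ∷ L)                               ∎
  where
  factor : ∀ a b x y g → a * (x * g) + b * (y * g) ≡ (a * x + b * y) * g
  factor = solve-∀

⟦⟧-extract : ∀ L₁ f L₂ x y → ⟦ L₁ ++ f ∷ L₂ ⟧ x y ≡ linear f x y ^ m f * ⟦ L₁ ++ L₂ ⟧ x y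
⟦⟧-extract []       f L₂ x y = refl
⟦⟧-extract (g ∷ L₁) f L₂ x y =
  trans (cong (linear g x y ^ m g *_) (⟦⟧-extract L₁ f L₂ x y)) (swap (linear g x y ^ m g) (linear f x y ^ m f) (⟦ L₁ ++ L₂ ⟧ x y))
  where
  swap : ∀ a b c → a * (b * c) ≡ b * (a * c)
  swap = solve-∀

∣-‿* : ∀ {d} x x′ y y′ → d ∣ x - x′ → d ∣ y - y′ → d ∣ x * y - x′ * y′
∣-‿* {d} x x′ y y′ d∣x d∣y =
  subst (d ∣_) (telescope x x′ y y′) (∣m∣n⇒∣m+n (∣m⇒∣m*n y d∣x) (∣n⇒∣m*n x′ d∣y))
  where
  telescope : ∀ x x′ y y′ → (x - x′) * y + x′ * (y - y′) ≡ x * y - x′ * y′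
  telescope = solve-∀

∣-‿^ : ∀ {d} x x′ n → d ∣ x - x′ → d ∣ x ^ n - x′ ^ n
∣-‿^ x x′ zero    d∣x = divides 0ℤ refl
∣-‿^ x x′ (suc n) d∣x = ∣-‿* x x′ (x ^ n) (x′ ^ n) d∣x (∣-‿^ x x′ n d∣x)

⟦⟧-cong-∣ : ∀ L {d} x x′ y → d ∣ x - x′ → d ∣ ⟦ L ⟧ x y - ⟦ L ⟧ x′ y
⟦⟧-cong-∣ []      x x′ y d∣x = divides 0ℤ refl
⟦⟧-cong-∣ (f ∷ L) {d} x x′ y d∣x =
  ∣-‿* (linear f x y ^ m f) (linear f x′ y ^ m f) (⟦ L ⟧ x y) (⟦ L ⟧ x′ y)
    (∣-‿^ (linear f x y) (linear f x′ y) (m f) (subst (d ∣_) (sym (difference (a f) (b f) x x′ y)) (∣n⇒∣m*n (a f) d∣x))) 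
    (⟦⟧-cong-∣ L x x′ y d∣x)
  where
  difference : ∀ a b x x′ y → (a * x + b * y) - (a * x′ + b * y) ≡ a * (x - x′)
  difference = solve-∀

-- Valuations of values at large primes

Admissible : ℕ → Set
Admissible v = 15 ℕ.∣ v ⊎ 21 ℕ.∣ v ⊎ 35 ℕ.∣ v

admissible-*ʳ : ∀ {v} w → Admissible v → Admissible (v ℕ.* w)
admissible-*ʳ w = Sum.map (ℕ.∣m⇒∣m*n w) (Sum.map (ℕ.∣m⇒∣m*n w) (ℕ.∣m⇒∣m*n w))

-- 105 is a common multiple of 15, 21 and 35, so `v` stays in its class.
admissible-+ : ∀ {v w} → Admissible v → 105 ℕ.∣ w → Admissible (v ℕ.+ w)
admissible-+ (inj₁ d)        105∣w = inj₁ (ℕ.∣m∣n⇒∣m+n d (ℕ.∣-trans (ℕ.divides 7 refl) 105∣w))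
admissible-+ (inj₂ (inj₁ d)) 105∣w = inj₂ (inj₁ (ℕ.∣m∣n⇒∣m+n d (ℕ.∣-trans (ℕ.divides 5 refl) 105∣w)))
admissible-+ (inj₂ (inj₂ d)) 105∣w = inj₂ (inj₂ (ℕ.∣m∣n⇒∣m+n d (ℕ.∣-trans (ℕ.divides 3 refl) 105∣w)))

-- Any two of 15, 21 and 35 have a common factor.
admissible-gap : ∀ {v w} → Admissible v → Admissible w → v ≢ suc w
admissible-gap = λ where
    (inj₁ d)        (inj₁ e)        → gap 3 (ℕ.divides 5 refl)  (ℕ.divides 5 refl)  d e
    (inj₁ d)        (inj₂ (inj₁ e)) → gap 3 (ℕ.divides 5 refl)  (ℕ.divides 7 refl)  d e
    (inj₁ d)        (inj₂ (inj₂ e)) → gap 5 (ℕ.divides 3 refl)  (ℕ.divides 7 refl)  d e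
    (inj₂ (inj₁ d)) (inj₁ e)        → gap 3 (ℕ.divides 7 refl)  (ℕ.divides 5 refl)  d e
    (inj₂ (inj₁ d)) (inj₂ (inj₁ e)) → gap 3 (ℕ.divides 7 refl)  (ℕ.divides 7 refl)  d e
    (inj₂ (inj₁ d)) (inj₂ (inj₂ e)) → gap 7 (ℕ.divides 3 refl)  (ℕ.divides 5 refl)  d e
    (inj₂ (inj₂ d)) (inj₁ e)        → gap 5 (ℕ.divides 7 refl)  (ℕ.divides 3 refl)  d e
    (inj₂ (inj₂ d)) (inj₂ (inj₁ e)) → gap 7 (ℕ.divides 5 refl)  (ℕ.divides 3 refl)  d e
    (inj₂ (inj₂ d)) (inj₂ (inj₂ e)) → gap 5 (ℕ.divides 7 refl)  (ℕ.divides 7 refl)  d e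
  where
  gap : ∀ g {c d v w} .{{_ : ℕ.NonTrivial g}} → g ℕ.∣ c → g ℕ.∣ d → c ℕ.∣ v → d ℕ.∣ w → v ≢ suc w
  gap g {w = w} g∣c g∣d c∣v d∣w refl =
    ℕ.nonTrivial⇒≢1 (ℕ.∣1⇒≡1 (ℕ.∣m+n∣m⇒∣n (subst (g ℕ.∣_) (ℕ.+-comm 1 w) (ℕ.∣-trans g∣c c∣v)) (ℕ.∣-trans g∣d d∣w)))

module _ {q : ℕ} (qp : Prime q) where

  -- Cramer's rule: the determinant times either coordinate is an integer combination of the two
  -- values.
  ∣linear²⇒∣ : ∀ f g {x y} → ¬ (+ q ∣ det f g) → + q ∣ linear f x y → + q ∣ linear g x y →
               + q ∣ x × + q ∣ y
  ∣linear²⇒∣ f g {x} {y} q∤det q∣f q∣g =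
      cancel x (subst (+ q ∣_) (elim-y (a f) (b f) (a g) (b g) x y)
                 (∣m∣n⇒∣m-n (∣n⇒∣m*n (b g) q∣f) (∣n⇒∣m*n (b f) q∣g)))
    , cancel y (subst (+ q ∣_) (elim-x (a f) (b f) (a g) (b g) x y)
                 (∣m∣n⇒∣m-n (∣n⇒∣m*n (a f) q∣g) (∣n⇒∣m*n (a g) q∣f)))
    where
    cancel : ∀ z → + q ∣ det f g * z → + q ∣ z
    cancel z d = [ (λ q∣det → contradiction q∣det q∤det) , (λ q∣z → q∣z) ]′ (euclidsLemmaℤ qp (det f g) z d)
    elim-y : ∀ a b c d x y → d * (a * x + b * y) - b * (c * x + d * y) ≡ (a * d - c * b) * x
    elim-y = solve-∀
    elim-x : ∀ a b c d x y → a * (c * x + d * y) - c * (a * x + b * y) ≡ (a * d - c * b) * y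
    elim-x = solve-∀

  ⟦⟧-unit : ∀ {L x y} → All (λ f → ¬ (+ q ∣ linear f x y)) L → Val q (⟦ L ⟧ x y) 0
  ⟦⟧-unit []                       = val-1 qp
  ⟦⟧-unit {f ∷ L} {x} {y} (q∤f ∷ q∤L) =
    subst (Val q _) (cong (ℕ._+ 0) (ℕ.*-zeroʳ (m f)))
      (val-* qp (val-^ qp (val-unit qp q∤f) (m f)) (⟦⟧-unit q∤L))

  -- Factors prime to `q` are skipped. At the first factor divisible by `q` all later ones are units
  -- by `∣linear²⇒∣`, so the valuation is a multiple of its exponent; without such a factor it is 0.
  ⟦⟧-primitive-val : ∀ {L x y} → AllPairs (λ f g → ¬ (+ q ∣ det f g)) L → All (λ f → Admissible (m f)) L →
                     ¬ (+ q ∣ x × + q ∣ y) → ⟦ L ⟧ x y ≢ 0ℤ → ∃[ v ] (Val q (⟦ L ⟧ x y) v × Admissible v)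
  ⟦⟧-primitive-val [] [] q∤xy L≢0 = 0 , val-1 qp , inj₁ (15 ℕ.∣0)
  ⟦⟧-primitive-val {f ∷ L} {x} {y} (f-L ∷ L-L) (adm-f ∷ adm-L) q∤xy fL≢0 with + q ∣? linear f x y
  ... | no q∤f =
    let v , vL , adm = ⟦⟧-primitive-val L-L adm-L q∤xy
          (λ L≡0 → fL≢0 (trans (cong (linear f x y ^ m f *_) L≡0) (ℤ.*-zeroʳ (linear f x y ^ m f))))
    in v , subst (Val q _) (cong (ℕ._+ v) (ℕ.*-zeroʳ (m f)))
             (val-* qp (val-^ qp (val-unit qp q∤f) (m f)) vL) , adm
  ... | yes q∣f with m f in m-f
  -- Exponent 0 is treated apart: the linear form may then vanish although the product does not, and
  -- `val-exists` would not apply.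
  ...   | zero  = 0 , val-* qp (val-1 qp) (⟦⟧-unit (All.map (λ {g} q∤det q∣g → q∤xy (∣linear²⇒∣ f g q∤det q∣f q∣g)) f-L)) , inj₁ (15 ℕ.∣0)
  ...   | suc k =
    let v , vf = val-exists qp {linear f x y} (λ f≡0 → fL≢0 (cong (λ z → z * z ^ k * ⟦ L ⟧ x y) f≡0))
    in suc k ℕ.* v
     , subst (Val q _) (ℕ.+-identityʳ _)
         (val-* qp (val-^ qp vf (suc k)) (⟦⟧-unit (All.map (λ {g} q∤det q∣g → q∤xy (∣linear²⇒∣ f g q∤det q∣f q∣g)) f-L)))
     , admissible-*ʳ v adm-f

  -- Dividing the coordinates by their gcd gives a primitive point. The gcd contributes the degree
  -- times its own valuation, a multiple of 105, which `admissible-+` absorbs. Positive degree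
  -- excludes the origin, where the gcd is 0.
  ⟦⟧-val : ∀ {L} → AllPairs (λ f g → ¬ (+ q ∣ det f g)) L → All (λ f → Admissible (m f)) L → 105 ℕ.∣ degree L → 0 < degree L →
           ∀ {x y} → ⟦ L ⟧ x y ≢ 0ℤ → ∃[ v ] (Val q (⟦ L ⟧ x y) v × Admissible v)
  ⟦⟧-val {L} L-L adm-L 105∣deg 0<deg {x} {y} L≢0
    with ∣ᵤ⇒∣ {ℤ.gcd x y} {x} (ℤ.gcd[i,j]∣i x y) | ∣ᵤ⇒∣ {ℤ.gcd x y} {y} (ℤ.gcd[i,j]∣j x y)
  ... | divides x′ x≡x′g | divides y′ y≡y′g = v ℕ.+ degree L ℕ.* w
      , subst (λ z → Val q z (v ℕ.+ degree L ℕ.* w)) (sym L≡) (val-* qp vL′ (val-^ qp vg (degree L)))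
      , admissible-+ adm (ℕ.∣m⇒∣m*n w 105∣deg)
    where
    g = ℤ.gcd x y
    L≡ : ⟦ L ⟧ x y ≡ ⟦ L ⟧ x′ y′ * g ^ degree L
    L≡ = trans (cong₂ ⟦ L ⟧ x≡x′g y≡y′g) (⟦⟧-scale L x′ y′ g)
    L′≢0 : ⟦ L ⟧ x′ y′ ≢ 0ℤ
    L′≢0 L′≡0 = L≢0 (trans L≡ (cong (_* g ^ degree L) L′≡0))
    0^ : ∀ {n} → 0 < n → 0ℤ ^ n ≡ 0ℤ
    0^ (s≤s _) = refl
    g≢0 : g ≢ 0ℤ
    g≢0 g≡0 = L≢0 (trans L≡ (trans (cong (λ z → ⟦ L ⟧ x′ y′ * z ^ degree L) g≡0)
      (trans (cong (⟦ L ⟧ x′ y′ *_) (0^ 0<deg)) (ℤ.*-zeroʳ (⟦ L ⟧ x′ y′)))))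
    q-val = val-exists qp g≢0
    w  = proj₁ q-val
    vg = proj₂ q-val
    lift : ∀ {z z′} → z ≡ z′ * g → + q ∣ z′ → + q * g ∣ z
    lift {z} {z′} eq (divides c refl) = divides c (trans eq (ℤ.*-assoc c (+ q) g))
    q∤x′y′ : ¬ (+ q ∣ x′ × + q ∣ y′)
    -- Otherwise q g would be a common divisor of x and y, hence divide g.
    q∤x′y′ (q∣x′ , q∣y′)
      with ∣ᵤ⇒∣ {+ q * g} {g} (ℤ.gcd-greatest {x} {y} {+ q * g} (∣⇒∣ᵤ (lift {x} x≡x′g q∣x′)) (∣⇒∣ᵤ (lift {y} y≡y′g q∣y′)))
    ... | divides c eq = ∤1 qp (divides c (ℤ.*-cancelʳ-≡ _ _ g {{≢-nonZero g≢0}}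
            (trans (ℤ.*-identityˡ g) (trans eq (sym (ℤ.*-assoc c (+ q) g))))))
    primitive-val = ⟦⟧-primitive-val L-L adm-L q∤x′y′ L′≢0
    v   = proj₁ primitive-val
    vL′ = proj₁ (proj₂ primitive-val)
    adm = proj₂ (proj₂ primitive-val)

-- Expansion into polynomials in n variables

module _ {n : ℕ} where

  _∙_ : Term n → Term n → Term n
  (c , e) ∙ (d , f) = c * d , Vec.zipWith ℕ._+_ e f

  1ₚ : Poly n
  1ₚ = (1ℤ , Vec.replicate n 0) ∷ []

  _*ₚ_ : Poly n → Poly n → Poly n
  _*ₚ_ = cartesianProductWith _∙_

  _^ₚ_ : Poly n → ℕ → Poly n
  F ^ₚ zero  = 1ₚ
  F ^ₚ suc k = F *ₚ (F ^ₚ k)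

  -- `X` and `Y` are the exponent vectors of the monomials substituted for the two variables; the
  -- zero vector as `Y` dehomogenises.
  formAt : (X Y : Vec ℕ n) → List LinearPower → Poly n
  formAt X Y []      = 1ₚ
  formAt X Y (f ∷ L) = (((a f , X) ∷ (b f , Y) ∷ []) ^ₚ m f) *ₚ formAt X Y L

monomial : ∀ {n} → Vec ℤ n → Vec ℕ n → ℤ
monomial x e = Vec.foldr′ _*_ 1ℤ (Vec.zipWith _^_ x e)

monomial-0 : ∀ {n} (x : Vec ℤ n) → monomial x (Vec.replicate n 0) ≡ 1ℤ
monomial-0 []      = refl
monomial-0 (x ∷ v) = trans (ℤ.*-identityˡ _) (monomial-0 v)

monomial-+ : ∀ {n} (x : Vec ℤ n) e f → monomial x (Vec.zipWith ℕ._+_ e f) ≡ monomial x e * monomial x f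
monomial-+ []      []      []      = refl
monomial-+ (x ∷ v) (i ∷ e) (j ∷ f) =
  trans (cong₂ _*_ (ℤ.^-distribˡ-+-* x i j) (monomial-+ v e f))
        (*-interchange (x ^ i) (x ^ j) (monomial v e) (monomial v f))

module _ {n : ℕ} (x : Vec ℤ n) where

  eval-∙ : ∀ t s → evalTerm (t ∙ s) x ≡ evalTerm t x * evalTerm s x
  eval-∙ (c , e) (d , f) =
    trans (cong (c * d *_) (monomial-+ x e f)) (*-interchange c d (monomial x e) (monomial x f))

  eval-++ : ∀ F G → eval (F ++ G) x ≡ eval F x + eval G x
  eval-++ []      G = sym (ℤ.+-identityˡ _)
  eval-++ (t ∷ F) G = trans (cong (λ z → evalTerm t x + z) (eval-++ F G)) (sym (ℤ.+-assoc (evalTerm t x) _ _))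

  eval-map-∙ : ∀ t G → eval (map (t ∙_) G) x ≡ evalTerm t x * eval G x
  eval-map-∙ t []      = sym (ℤ.*-zeroʳ (evalTerm t x))
  eval-map-∙ t (s ∷ G) = trans (cong₂ _+_ (eval-∙ t s) (eval-map-∙ t G))
    (sym (ℤ.*-distribˡ-+ (evalTerm t x) (evalTerm s x) (eval G x)))

  eval-*ₚ : ∀ F G → eval (F *ₚ G) x ≡ eval F x * eval G x
  eval-*ₚ []      G = refl
  eval-*ₚ (t ∷ F) G = begin
    eval (map (t ∙_) G ++ F *ₚ G) x               ≡⟨ eval-++ (map (t ∙_) G) (F *ₚ G) ⟩
    eval (map (t ∙_) G) x + eval (F *ₚ G) x       ≡⟨ cong₂ _+_ (eval-map-∙ t G) (eval-*ₚ F G) ⟩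
    evalTerm t x * eval G x + eval F x * eval G x ≡⟨ ℤ.*-distribʳ-+ (eval G x) (evalTerm t x) (eval F x) ⟨
    eval (t ∷ F) x * eval G x                     ∎

  eval-1ₚ : eval 1ₚ x ≡ 1ℤ
  eval-1ₚ = trans (ℤ.+-identityʳ _) (trans (ℤ.*-identityˡ _) (monomial-0 x))

  eval-^ₚ : ∀ F k → eval (F ^ₚ k) x ≡ eval F x ^ k
  eval-^ₚ F zero    = eval-1ₚ
  eval-^ₚ F (suc k) = trans (eval-*ₚ F (F ^ₚ k)) (cong (eval F x *_) (eval-^ₚ F k))

  eval-formAt : ∀ X Y L → eval (formAt X Y L) x ≡ ⟦ L ⟧ (monomial x X) (monomial x Y)
  eval-formAt X Y []      = eval-1ₚ
  eval-formAt X Y (f ∷ L) = trans (eval-*ₚ (_ ^ₚ m f) (formAt X Y L))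
    (cong₂ _*_ (trans (eval-^ₚ ((a f , X) ∷ (b f , Y) ∷ []) (m f))
                      (cong (λ z → (a f * monomial x X + z) ^ m f) (ℤ.+-identityʳ (b f * monomial x Y))))
               (eval-formAt X Y L))

-- Homogeneity

HasDegree : ∀ {n} → ℕ → Term n → Set
HasDegree d t = Vec.sum (proj₂ t) ≡ d

sum-replicate-0 : ∀ n → Vec.sum (Vec.replicate n 0) ≡ 0
sum-replicate-0 zero    = refl
sum-replicate-0 (suc n) = sum-replicate-0 n

sum-zipWith-+ : ∀ {n} (e f : Vec ℕ n) → Vec.sum (Vec.zipWith ℕ._+_ e f) ≡ Vec.sum e ℕ.+ Vec.sum f
sum-zipWith-+ []      []      = refl
sum-zipWith-+ (i ∷ e) (j ∷ f) = trans (cong (i ℕ.+ j ℕ.+_) (sum-zipWith-+ e f)) (ℕ-interchange i j _ _)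
  where
  ℕ-interchange : ∀ i j k l → i ℕ.+ j ℕ.+ (k ℕ.+ l) ≡ i ℕ.+ k ℕ.+ (j ℕ.+ l)
  ℕ-interchange = ℕ-Solver.solve-∀

module _ {n : ℕ} where

  1ₚ-degree : All (HasDegree 0) (1ₚ {n})
  1ₚ-degree = sum-replicate-0 n ∷ []

  *ₚ-degree : ∀ {c d} {F G : Poly n} → All (HasDegree c) F → All (HasDegree d) G → All (HasDegree (c ℕ.+ d)) (F *ₚ G)
  *ₚ-degree []               G-deg = []
  *ₚ-degree {F = t ∷ F} (t-deg ∷ F-deg) G-deg = All.++⁺
    (All.map⁺ (All.map (λ {s} s-deg → trans (sum-zipWith-+ (proj₂ t) (proj₂ s)) (cong₂ ℕ._+_ t-deg s-deg)) G-deg))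
    (*ₚ-degree F-deg G-deg)

  ^ₚ-degree : ∀ {d} {F : Poly n} → All (HasDegree d) F → ∀ k → All (HasDegree (k ℕ.* d)) (F ^ₚ k)
  ^ₚ-degree F-deg zero    = 1ₚ-degree
  ^ₚ-degree F-deg (suc k) = *ₚ-degree F-deg (^ₚ-degree F-deg k)

  formAt-degree : ∀ {X Y : Vec ℕ n} → Vec.sum X ≡ 1 → Vec.sum Y ≡ 1 → ∀ L → All (HasDegree (degree L)) (formAt X Y L)
  formAt-degree X-deg Y-deg []      = 1ₚ-degree
  formAt-degree X-deg Y-deg (f ∷ L) = *ₚ-degree
    (subst (λ d → All (HasDegree d) (_ ^ₚ m f)) (ℕ.*-identityʳ (m f)) (^ₚ-degree (X-deg ∷ Y-deg ∷ []) (m f)))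
    (formAt-degree X-deg Y-deg L)

  -- A nonzero collected coefficient at `e` requires some term with exponent vector `e`, and each
  -- single term has degree `d`.
  homogeneous : ∀ {d} {F : Poly n} → All (HasDegree d) F → IsHomogeneous d F
  homogeneous []                      e c≢0 = contradiction refl c≢0
  homogeneous {F = t ∷ F} (t-deg ∷ F-deg) e c≢0 with ≡-dec ℕ._≟_ (proj₂ t) e
  ... | yes refl = t-deg
  ... | no  _    = homogeneous {F = F} F-deg e c≢0

-- Values near a root

^-mono-∣ : ∀ x {m n} → m ≤ n → x ^ m ∣ x ^ n
^-mono-∣ x {m} {n} m≤n = divides (x ^ (n ℕ.∸ m)) (begin
  x ^ n                     ≡⟨ cong (x ^_) (ℕ.m∸n+n≡m m≤n) ⟨
  x ^ (n ℕ.∸ m ℕ.+ m)       ≡⟨ ℤ.^-distribˡ-+-* x (n ℕ.∸ m) m ⟩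
  x ^ (n ℕ.∸ m) * x ^ m     ∎)

-- At r + p^e the factor with root r equals (p^e)^m, while the remaining product keeps its valuation
-- V from r because e exceeds V.
val-near-root : ∀ {p} (pp : Prime p) {L} L₁ L₂ r {m V e} → L ≡ L₁ ++ (1ℤ X+ - r Y^ m) ∷ L₂ →
  Val p (⟦ L₁ ++ L₂ ⟧ r 1ℤ) V → V < e → Val p (⟦ L ⟧ (r + (+ p) ^ e) 1ℤ) (m ℕ.* e ℕ.+ V)
val-near-root {p} pp L₁ L₂ r {m} {V} {e} refl vr V<e =
  subst (λ z → Val p z (m ℕ.* e ℕ.+ V)) (sym (⟦⟧-extract L₁ (1ℤ X+ - r Y^ m) L₂ (r + (+ p) ^ e) 1ℤ))
    (val-* pp
      (val-^ pp (subst (λ z → Val p z e) (sym (shift r ((+ p) ^ e))) (val-p^ pp e)) m)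
      (val-near pp vr (∣-trans (^-mono-∣ (+ p) V<e)
        (⟦⟧-cong-∣ (L₁ ++ L₂) (r + (+ p) ^ e) r 1ℤ (divides 1ℤ (difference r ((+ p) ^ e)))))))
  where
  shift : ∀ r P → 1ℤ * (r + P) + - r * 1ℤ ≡ P
  shift = solve-∀
  difference : ∀ r P → (r + P) - r ≡ 1ℤ * P
  difference = solve-∀

-- Powers and roots of odd numbers modulo powers of 2

val0⇒∤ : ∀ {p x} → Val p x 0 → ¬ (+ p ∣ x)
val0⇒∤ {p} (val c refl p∤c) p∣x = p∤c (subst (+ p ∣_) (ℤ.*-identityˡ c) p∣x)

odd⇒2∣-1 : ∀ x → ¬ (+ 2 ∣ x) → + 2 ∣ x - 1ℤ
odd⇒2∣-1 x 2∤x with x ℤ.%ℕ 2 | ℤ.n%ℕd<d x 2 | ℤ.a≡a%ℕn+[a/ℕn]*n x 2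
... | 0           | _             | eq = contradiction (divides (x ℤ./ℕ 2) (trans eq (ℤ.+-identityˡ _))) 2∤x
... | 1           | _             | eq = divides (x ℤ./ℕ 2) (trans (cong (_- 1ℤ) eq) (cancel (x ℤ./ℕ 2)))
  where
  cancel : ∀ q → 1ℤ + q * + 2 - 1ℤ ≡ q * + 2
  cancel = solve-∀
... | suc (suc _) | s≤s (s≤s ()) | _

∣^-1 : ∀ {d} x n → d ∣ x - 1ℤ → d ∣ x ^ n - 1ℤ
∣^-1 {d} x n d∣ = subst (λ z → d ∣ x ^ n - z) (ℤ.^-zeroˡ n) (∣-‿^ x 1ℤ n d∣)

-- If 2^K divides X - 1 and X is odd, then 2^(K+1) divides (X - 1)(X + 1) = X² - 1, and this
-- survives the further 8th power. The base is 16 because 16 is 1 modulo 15.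
^16^-1 : ∀ {x} → ¬ (+ 2 ∣ x) → ∀ K → (+ 2) ^ K ∣ x ^ (16 ℕ.^ K) - 1ℤ
^16^-1 {x} 2∤x zero    = divides (x ^ 1 - 1ℤ) (sym (ℤ.*-identityʳ _))
^16^-1 {x} 2∤x (suc K) with x ^ (16 ℕ.^ K) in x^16^K≡X | ^16^-1 2∤x K | ∣^-1 x (16 ℕ.^ K) (odd⇒2∣-1 x 2∤x)
... | X | divides q eq | divides s eq₂ = subst (λ z → (+ 2) ^ suc K ∣ z - 1ℤ) X^2^8 (∣^-1 (X ^ 2) 8
      (divides (q * (s + 1ℤ)) (begin
        X * (X * 1ℤ) - 1ℤ                        ≡⟨ factor X ⟩
        (X - 1ℤ) * ((X - 1ℤ) + + 2)              ≡⟨ cong₂ (λ y z → y * (z + + 2)) eq eq₂ ⟩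
        q * (+ 2) ^ K * (s * + 2 + + 2)          ≡⟨ regroup q ((+ 2) ^ K) s ⟩
        q * (s + 1ℤ) * (+ 2 * (+ 2) ^ K)         ∎)))
  where
  factor : ∀ X → X * (X * 1ℤ) - 1ℤ ≡ (X - 1ℤ) * ((X - 1ℤ) + + 2)
  factor = solve-∀
  regroup : ∀ q P s → q * P * (s * + 2 + + 2) ≡ q * (s + 1ℤ) * (+ 2 * P)
  regroup = solve-∀
  X^2^8 : (X ^ 2) ^ 8 ≡ x ^ (16 ℕ.^ suc K)
  X^2^8 = begin
    (X ^ 2) ^ 8                 ≡⟨ ℤ.^-*-assoc X 2 8 ⟩
    X ^ 16                      ≡⟨ cong (_^ 16) x^16^K≡X ⟨
    (x ^ (16 ℕ.^ K)) ^ 16       ≡⟨ ℤ.^-*-assoc x (16 ℕ.^ K) 16 ⟩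
    x ^ (16 ℕ.^ K ℕ.* 16)       ≡⟨ cong (x ^_) (ℕ.*-comm (16 ℕ.^ K) 16) ⟩
    x ^ (16 ℕ.^ suc K)          ∎

-- Provides the hypothesis of `odd-root` for 15th roots.
16^≡1+*15 : ∀ K → ∃[ n ] 16 ℕ.^ K ≡ suc (n ℕ.* 15)
16^≡1+*15 zero    = 0 , refl
16^≡1+*15 (suc K) = let n , eq = 16^≡1+*15 K in 16 ℕ.* n ℕ.+ 1 , trans (cong (16 ℕ.*_) eq) (step n)
  where
  step : ∀ n → 16 ℕ.* (1 ℕ.+ n ℕ.* 15) ≡ 1 ℕ.+ (16 ℕ.* n ℕ.+ 1) ℕ.* 15
  step = ℕ-Solver.solve-∀

-- With N = 1 + nm a multiple of the order of the odd residues modulo 2^K, odd z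
-- satisfy z^(nm) ≡ 1/z, so (A/B)^n is an m-th root of B/A; the inverse of B is
-- represented by B^(nm).
odd-root : ∀ {A B} → ¬ (+ 2 ∣ A) → ¬ (+ 2 ∣ B) → ∀ K m n → 16 ℕ.^ K ≡ suc (n ℕ.* m) →
           ∃[ τ ] (+ 2) ^ K ∣ A * τ ^ m - B
odd-root {A} {B} 2∤A 2∤B K m n 16^K≡ = D ^ n
    , subst ((+ 2) ^ K ∣_) (combine A B Bⁿᵐ ((D ^ n) ^ m))
        (∣m∣n⇒∣m-n (∣n⇒∣m*n B D-inverse) (∣n⇒∣m*n (A * (D ^ n) ^ m) (unit-power 2∤B)))
  where
  Bⁿᵐ = B ^ (n ℕ.* m)
  D = A * Bⁿᵐ
  unit-power : ∀ {x} → ¬ (+ 2 ∣ x) → (+ 2) ^ K ∣ x * x ^ (n ℕ.* m) - 1ℤ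
  unit-power {x} 2∤x = subst (λ N → (+ 2) ^ K ∣ x ^ N - 1ℤ) 16^K≡ (^16^-1 2∤x K)
  2∤D : ¬ (+ 2 ∣ D)
  2∤D 2∣D = [ 2∤A , val0⇒∤ (subst (Val 2 Bⁿᵐ) (ℕ.*-zeroʳ (n ℕ.* m))
      (val-^ prime[2] (val-unit prime[2] 2∤B) (n ℕ.* m))) ]′ (euclidsLemmaℤ prime[2] A Bⁿᵐ 2∣D)
  D-inverse : (+ 2) ^ K ∣ D * (D ^ n) ^ m - 1ℤ
  D-inverse = subst (λ z → (+ 2) ^ K ∣ D * z - 1ℤ) (sym (ℤ.^-*-assoc D n m)) (unit-power 2∤D)
  combine : ∀ A B P T → B * (A * P * T - 1ℤ) - A * T * (B * P - 1ℤ) ≡ A * T - B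
  combine = solve-∀

-- At x = -1 + 2^i τ the first factor is (2^i τ)^m and the others are constant
-- modulo 2^(C+K), so it remains to choose τ by odd-root.
prescribed-odd-part : ∀ {L′} L m {C} → L′ ≡ (1ℤ X+ 1ℤ Y^ m) ∷ L → Val 2 (⟦ L ⟧ -1ℤ 1ℤ) C →
  ∀ {B w} → ¬ (+ 2 ∣ B) → ¬ (+ 2 ∣ w) → ∀ K n → 16 ℕ.^ K ≡ suc (n ℕ.* m) → ∀ i → C ℕ.+ K ≤ i →
  ∃[ x ] ∃[ g ] (⟦ L′ ⟧ x 1ℤ * w ≡ (+ 2) ^ (i ℕ.* m ℕ.+ C) * g × (+ 2) ^ K ∣ g - B)
prescribed-odd-part L m {C} refl (val c L≡ 2∤c) {B} {w} 2∤B 2∤w K n 16^K≡ i C+K≤i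
  -- The odd part of the product is w c τ^m modulo 2^K, so the multiplier w and the constant c are
  -- compensated by τ.
  with odd-root {w * c} (λ d → [ 2∤w , 2∤c ]′ (euclidsLemmaℤ prime[2] w c d)) 2∤B K m n 16^K≡
... | τ , wcτᵐ≡B = x , g , value , g≡B
  where
  h = (+ 2) ^ i * τ
  x = -1ℤ + h
  near : (+ 2) ^ (C ℕ.+ K) ∣ ⟦ L ⟧ x 1ℤ - ⟦ L ⟧ -1ℤ 1ℤ
  near = ⟦⟧-cong-∣ L x -1ℤ 1ℤ
    (subst ((+ 2) ^ (C ℕ.+ K) ∣_) (difference h) (∣m⇒∣m*n τ (^-mono-∣ (+ 2) C+K≤i)))
    where
    difference : ∀ h → h ≡ (-1ℤ + h) - -1ℤ
    difference = solve-∀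
  z = _∣_.quotient near
  T = τ ^ m
  P = (+ 2) ^ K
  g = (c + z * P) * w * T
  g≡B : P ∣ g - B
  g≡B = subst (P ∣_) (split w c T z P B) (∣m∣n⇒∣m+n wcτᵐ≡B (divides (z * w * T) refl))
    where
    split : ∀ w c T z P B → (w * c * T - B) + z * w * T * P ≡ (c + z * P) * w * T - B
    split = solve-∀
  L-value : ⟦ L ⟧ x 1ℤ ≡ (+ 2) ^ C * (c + z * P)
  L-value = begin
    ⟦ L ⟧ x 1ℤ                                    ≡⟨ add (⟦ L ⟧ x 1ℤ) (⟦ L ⟧ -1ℤ 1ℤ) ⟩
    (⟦ L ⟧ x 1ℤ - ⟦ L ⟧ -1ℤ 1ℤ) + ⟦ L ⟧ -1ℤ 1ℤ    ≡⟨ cong₂ _+_ (_∣_.equality near) L≡ ⟩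
    z * (+ 2) ^ (C ℕ.+ K) + (+ 2) ^ C * c         ≡⟨ cong (λ y → z * y + (+ 2) ^ C * c) (ℤ.^-distribˡ-+-* (+ 2) C K) ⟩
    z * ((+ 2) ^ C * P) + (+ 2) ^ C * c           ≡⟨ collect z ((+ 2) ^ C) P c ⟩
    (+ 2) ^ C * (c + z * P)                       ∎
    where
    add : ∀ y y′ → y ≡ (y - y′) + y′
    add = solve-∀
    collect : ∀ z Q P c → z * (Q * P) + Q * c ≡ Q * (c + z * P)
    collect = solve-∀
  head-value : (1ℤ * x + 1ℤ * 1ℤ) ^ m ≡ (+ 2) ^ (i ℕ.* m) * T
  head-value = begin
    (1ℤ * x + 1ℤ * 1ℤ) ^ m     ≡⟨ cong (_^ m) (shift h) ⟩
    ((+ 2) ^ i * τ) ^ m        ≡⟨ ^-distribʳ-* ((+ 2) ^ i) τ m ⟩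
    ((+ 2) ^ i) ^ m * T        ≡⟨ cong (_* T) (ℤ.^-*-assoc (+ 2) i m) ⟩
    (+ 2) ^ (i ℕ.* m) * T      ∎
    where
    shift : ∀ h → 1ℤ * (-1ℤ + h) + 1ℤ * 1ℤ ≡ h
    shift = solve-∀
  value : ⟦ (1ℤ X+ 1ℤ Y^ m) ∷ L ⟧ x 1ℤ * w ≡ (+ 2) ^ (i ℕ.* m ℕ.+ C) * g
  value = begin
    (1ℤ * x + 1ℤ * 1ℤ) ^ m * ⟦ L ⟧ x 1ℤ * w                   ≡⟨ cong₂ (λ y y′ → y * y′ * w) head-value L-value ⟩
    (+ 2) ^ (i ℕ.* m) * T * ((+ 2) ^ C * (c + z * P)) * w     ≡⟨ regroup ((+ 2) ^ (i ℕ.* m)) T ((+ 2) ^ C) (c + z * P) w ⟩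
    (+ 2) ^ (i ℕ.* m) * (+ 2) ^ C * g                         ≡⟨ cong (_* g) (ℤ.^-distribˡ-+-* (+ 2) (i ℕ.* m) C) ⟨
    (+ 2) ^ (i ℕ.* m ℕ.+ C) * g                               ∎
    where
    regroup : ∀ I T C d w → I * T * (C * d) * w ≡ I * C * (d * w * T)
    regroup = solve-∀

-- The bound 92 exceeds the values 15, 56 and 91 of V that occur for factors.
Denominators : (ℤ → ℤ) → Set
Denominators f = ∀ ρ → ∃[ V ] (3 ℕ.∣ ρ ℕ.+ V × (∀ e → 92 ≤ e → ∃[ y ] Val 2 (f y) (21 ℕ.* e ℕ.+ V)))

-- Here 21 is the valuation at -1 of the product of the factors not vanishing there.
Numerators : (ℤ → ℤ) → Set
Numerators f = ∀ {B w} → ¬ (+ 2 ∣ B) → ¬ (+ 2 ∣ w) → ∀ K i → 21 ℕ.+ K ≤ i →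
  ∃[ x ] ∃[ g ] (f x * w ≡ (+ 2) ^ (i ℕ.* 15 ℕ.+ 21) * g × (+ 2) ^ K ∣ g - B)

-- Solves 15i - 21e = (vu + V) - (vw + 21) for large i and e.
balanced-exponents : ∀ vu vw V → 3 ℕ.∣ vu ℕ.+ 2 ℕ.* (vw ℕ.+ 21) ℕ.+ V → ∀ l →
  ∃[ e ] ∃[ i ] (l ≤ e × l ≤ i × vw ℕ.+ (i ℕ.* 15 ℕ.+ 21) ≡ vu ℕ.+ (21 ℕ.* e ℕ.+ V))
balanced-exponents vu vw V (ℕ.divides θ eq) l =
    -- With s = vw + 21 the equation divided by 3 reads 5i - 7e = θ - s. The pair (i, e) = (3, 2)
    -- yields 1, (4, 3) yields -1, and (7, 5) yields 0, so l copies of the last enlarge both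
    -- exponents.
    2 ℕ.* θ ℕ.+ 3 ℕ.* (vw ℕ.+ 21) ℕ.+ 5 ℕ.* l
  , 3 ℕ.* θ ℕ.+ 4 ℕ.* (vw ℕ.+ 21) ℕ.+ 7 ℕ.* l
  , ℕ.≤-trans (ℕ.m≤n*m l 5) (ℕ.m≤n+m (5 ℕ.* l) (2 ℕ.* θ ℕ.+ 3 ℕ.* (vw ℕ.+ 21)))
  , ℕ.≤-trans (ℕ.m≤n*m l 7) (ℕ.m≤n+m (7 ℕ.* l) (3 ℕ.* θ ℕ.+ 4 ℕ.* (vw ℕ.+ 21)))
  , ℕ.+-cancelʳ-≡ (2 ℕ.* (vw ℕ.+ 21)) _ _ (trans (left vw θ l)
      (trans (cong (42 ℕ.* θ ℕ.+ 63 ℕ.* (vw ℕ.+ 21) ℕ.+ 105 ℕ.* l ℕ.+_) (sym eq)) (right vu vw V θ l)))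
  where
  left : ∀ vw θ l → vw ℕ.+ ((3 ℕ.* θ ℕ.+ 4 ℕ.* (vw ℕ.+ 21) ℕ.+ 7 ℕ.* l) ℕ.* 15 ℕ.+ 21) ℕ.+ 2 ℕ.* (vw ℕ.+ 21)
                  ≡ 42 ℕ.* θ ℕ.+ 63 ℕ.* (vw ℕ.+ 21) ℕ.+ 105 ℕ.* l ℕ.+ θ ℕ.* 3
  left = ℕ-Solver.solve-∀
  right : ∀ vu vw V θ l → 42 ℕ.* θ ℕ.+ 63 ℕ.* (vw ℕ.+ 21) ℕ.+ 105 ℕ.* l ℕ.+ (vu ℕ.+ 2 ℕ.* (vw ℕ.+ 21) ℕ.+ V)
                        ≡ vu ℕ.+ (21 ℕ.* (2 ℕ.* θ ℕ.+ 3 ℕ.* (vw ℕ.+ 21) ℕ.+ 5 ℕ.* l) ℕ.+ V) ℕ.+ 2 ℕ.* (vw ℕ.+ 21)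
  right = ℕ-Solver.solve-∀

-- Approximation of fractions by ratios of values

cross-difference : ∀ {p u w X Y u′ w′ Y′ g} vu vw vY vX k →
  u ≡ (+ p) ^ vu * u′ → w ≡ (+ p) ^ vw * w′ → Y ≡ (+ p) ^ vY * Y′ → X * w′ ≡ (+ p) ^ vX * g →
  vw ℕ.+ vX ≡ vu ℕ.+ vY → (+ p) ^ (k ℕ.+ vw) ∣ g - u′ * Y′ → (+ p) ^ (vw ℕ.+ vY ℕ.+ k) ∣ u * Y - X * w
cross-difference {p} {u} {w} {X} {Y} {u′} {w′} {Y′} {g} vu vw vY vX k u≡ w≡ Y≡ X≡ exponents (divides q g≡) =
  -- Both products contain p^(vu + vY), with cofactors congruent modulo p^(k + vw). The surplus p^vu
  -- goes into the quotient.
  divides (- (q * Pu)) (begin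
    u * Y - X * w                               ≡⟨ cong₂ (λ a b → a - X * b) (cong₂ _*_ u≡ Y≡) w≡ ⟩
    Pu * u′ * (PY * Y′) - X * (Pw * w′)         ≡⟨ s₁ Pu u′ PY Y′ X Pw w′ ⟩
    Pu * PY * (u′ * Y′) - Pw * (X * w′)         ≡⟨ cong (λ z → Pu * PY * (u′ * Y′) - Pw * z) X≡ ⟩
    Pu * PY * (u′ * Y′) - Pw * (PX * g)         ≡⟨ cong (λ z → Pu * PY * (u′ * Y′) - z) (trans (sym (ℤ.*-assoc Pw PX g)) (cong (_* g) powers)) ⟩
    Pu * PY * (u′ * Y′) - Pu * PY * g           ≡⟨ s₂ Pu PY (u′ * Y′) g ⟩
    - ((g - u′ * Y′) * (Pu * PY))               ≡⟨ cong (λ z → - (z * (Pu * PY))) g≡ ⟩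
    - (q * P * (Pu * PY))                       ≡⟨ s₃ q P Pu PY ⟩
    - (q * Pu) * (P * PY)                       ≡⟨ cong (- (q * Pu) *_) modulus ⟩
    - (q * Pu) * (+ p) ^ (vw ℕ.+ vY ℕ.+ k)      ∎)
  where
  Pu = (+ p) ^ vu
  Pw = (+ p) ^ vw
  PX = (+ p) ^ vX
  PY = (+ p) ^ vY
  P  = (+ p) ^ (k ℕ.+ vw)
  s₁ : ∀ Pu u Py y f Pw w → Pu * u * (Py * y) - f * (Pw * w) ≡ Pu * Py * (u * y) - Pw * (f * w)
  s₁ = solve-∀
  s₂ : ∀ Pu Py B g → Pu * Py * B - Pu * Py * g ≡ - ((g - B) * (Pu * Py))
  s₂ = solve-∀
  s₃ : ∀ q P Pu Py → - (q * P * (Pu * Py)) ≡ - (q * Pu) * (P * Py)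
  s₃ = solve-∀
  powers : Pw * PX ≡ Pu * PY
  powers = trans (sym (ℤ.^-distribˡ-+-* (+ p) vw vX)) (trans (cong ((+ p) ^_) exponents) (ℤ.^-distribˡ-+-* (+ p) vu vY))
  modulus : P * PY ≡ (+ p) ^ (vw ℕ.+ vY ℕ.+ k)
  modulus = trans (sym (ℤ.^-distribˡ-+-* (+ p) (k ℕ.+ vw) vY)) (cong ((+ p) ^_) (rotate k vw vY))
    where
    rotate : ∀ k v w → k ℕ.+ v ℕ.+ w ≡ v ℕ.+ w ℕ.+ k
    rotate = ℕ-Solver.solve-∀

-- For u = 0 the root -1 gives the ratio 0 exactly. Otherwise y comes first, because the odd part
-- prescribed for the numerator is that of u times f y.
approximate : ∀ {f} → f -1ℤ ≡ 0ℤ → Denominators f → Numerators f → ∀ k u w → w ≢ 0ℤ →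
  ∃[ x ] ∃[ y ] ∃[ v ] (Val 2 (w * f y) v × (+ 2) ^ (v ℕ.+ k) ∣ u * f y - f x * w)
approximate {f} f-1≡0 denominator numerator k u w w≢0 = by-cases (u ℤ.≟ 0ℤ)
  where
  open Val
  w-val = proj₂ (val-exists prime[2] w≢0)
  vw = proj₁ (val-exists prime[2] w≢0)

  Goal : Set
  Goal = ∃[ x ] ∃[ y ] ∃[ v ] (Val 2 (w * f y) v × (+ 2) ^ (v ℕ.+ k) ∣ u * f y - f x * w)

  nonzero : ∀ {vu} → Val 2 u vu → Goal
  nonzero {vu} u-val =
    let V , 3∣ , near = denominator (vu ℕ.+ 2 ℕ.* (vw ℕ.+ 21))
        -- One bound serves both demands, 92 ≤ e and 21 + (k + vw) ≤ i.
        e , i , l≤e , l≤i , exponents = balanced-exponents vu vw V 3∣ (k ℕ.+ vw ℕ.+ 92)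
        y , y-val = near e (ℕ.≤-trans (ℕ.m≤n+m 92 (k ℕ.+ vw)) l≤e)
        x , g , x≡ , g≡ = numerator
          (λ d → [ p∤unit u-val , p∤unit y-val ]′ (euclidsLemmaℤ prime[2] (unit u-val) (unit y-val) d))
          (p∤unit w-val) (k ℕ.+ vw) i
          (ℕ.≤-trans (ℕ.≤-trans (ℕ.≤-reflexive (ℕ.+-comm 21 (k ℕ.+ vw))) (ℕ.+-monoʳ-≤ (k ℕ.+ vw) (ℕ.m≤m+n 21 71))) l≤i)
    in x , y , vw ℕ.+ (21 ℕ.* e ℕ.+ V) , val-* prime[2] w-val y-val ,
       cross-difference {X = f x} vu vw (21 ℕ.* e ℕ.+ V) (i ℕ.* 15 ℕ.+ 21) k
         (factorisation u-val) (factorisation w-val) (factorisation y-val) x≡ exponents g≡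

  zero-case : u ≡ 0ℤ → Goal
  zero-case u≡0 =
    let V , _ , near = denominator 0
        y , y-val    = near 92 ℕ.≤-refl
        v = vw ℕ.+ (21 ℕ.* 92 ℕ.+ V)
    in -1ℤ , y , v , val-* prime[2] w-val y-val ,
       subst ((+ 2) ^ (v ℕ.+ k) ∣_) (sym (cong₂ (λ a b → a * f y - b * w) u≡0 f-1≡0)) (divides 0ℤ refl)

  by-cases : Dec (u ≡ 0ℤ) → Goal
  by-cases (yes u≡0) = zero-case u≡0
  by-cases (no  u≢0) = nonzero (proj₂ (val-exists prime[2] u≢0))

-- From divisibility to density of the ratio set

‿-÷-cross : ∀ s r {X Y} → ↥ r * Y ≡ X * ↧ r → ↥ (s ℚ.- r) * (↧ s * Y) ≡ (↥ s * Y - X * ↧ s) * ↧ (s ℚ.- r)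
‿-÷-cross s r {X} {Y} cross = ℤ.*-cancelʳ-≡ _ _ (↧ r) (begin
  N * (↧ s * Y) * ↧ r                       ≡⟨ s₁ N (↧ s) Y (↧ r) ⟩
  N * (↧ s * ↧ r) * Y                       ≡⟨ cong (_* Y) (↥-‿-cross s r) ⟩
  (↥ s * ↧ r - ↥ r * ↧ s) * D * Y           ≡⟨ s₂ (↥ s) (↧ r) (↥ r) (↧ s) D Y ⟩
  (↥ s * Y * ↧ r - ↥ r * Y * ↧ s) * D       ≡⟨ cong (λ z → (↥ s * Y * ↧ r - z * ↧ s) * D) cross ⟩
  (↥ s * Y * ↧ r - X * ↧ r * ↧ s) * D       ≡⟨ s₃ (↥ s) Y (↧ r) X (↧ s) D ⟩
  (↥ s * Y - X * ↧ s) * D * ↧ r             ∎)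
  where
  N = ↥ (s ℚ.- r)
  D = ↧ (s ℚ.- r)
  s₁ : ∀ N w b d → N * (w * b) * d ≡ N * (w * d) * b
  s₁ = solve-∀
  s₂ : ∀ u d n w D b → (u * d - n * w) * D * b ≡ (u * b * d - n * b * w) * D
  s₂ = solve-∀
  s₃ : ∀ u b d a w D → (u * b * d - a * d * w) * D ≡ (u * b - a * w) * D * d
  s₃ = solve-∀

ℚ-telescope : ∀ a b c → (a ℚ.- b) ℚ.+ (b ℚ.- c) ≡ a ℚ.- c
ℚ-telescope a b c = begin
  (a ℚ.- b) ℚ.+ (b ℚ.- c)               ≡⟨ ℚ.+-assoc a (ℚ.- b) (b ℚ.- c) ⟩
  a ℚ.+ (ℚ.- b ℚ.+ (b ℚ.- c))           ≡⟨ cong (a ℚ.+_) (ℚ.+-assoc (ℚ.- b) b (ℚ.- c)) ⟨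
  a ℚ.+ (ℚ.- b ℚ.+ b ℚ.- c)             ≡⟨ cong (λ z → a ℚ.+ (z ℚ.- c)) (ℚ.+-inverseˡ b) ⟩
  a ℚ.+ (ℚ.0ℚ ℚ.- c)                    ≡⟨ cong (a ℚ.+_) (ℚ.+-identityˡ (ℚ.- c)) ⟩
  a ℚ.- c                               ∎

module _ {n : ℕ} (F : Poly n) where

  R⇒cross : ∀ {r} → R F r → ∃[ x ] ∃[ y ] (eval F y ≢ 0ℤ × ↥ r * eval F y ≡ eval F x * ↧ r)
  R⇒cross (x , y , Fy≢0 , r≡) = x , y , Fy≢0 , ÷-cross (eval F x) (eval F y) {{≢-nonZero Fy≢0}} r≡

  AdmissibleAt : ℕ → Set
  AdmissibleAt q = ∀ x → eval F x ≢ 0ℤ → ∃[ v ] (Val q (eval F x) v × Admissible v)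

  constant : ∀ q → Prime q → ℚ → ℚₚ q
  constant q qp s = record
    { seq    = λ _ → s
    ; cauchy = λ k → 0 , λ _ _ _ _ → subst (∣_∣[ q ]≤p^- k) (sym (ℚ.+-inverseʳ s))
        ((q ℕ.^ k) ℕ.∣0 , λ q∣1 → ∤1 qp (∣ᵤ⇒∣ q∣1))
    }

  -- The number q itself is not a limit of ratios.
  admissible⇒¬dense : ∀ {q} → Prime q → AdmissibleAt q → ¬ DenseInℚₚ q (R F)
  admissible⇒¬dense {q} qp adm dense =
    -- Agreement with q modulo q² forces the ratio to have valuation exactly 1.
    let r , r∈R , N , close = dense (constant q qp (fromℤ (+ q))) 2
        x , y , Fy≢0 , cross = R⇒cross r∈R
        d , e , q∤d , q∤e , eq = near-p qp r {eval F x} {eval F y} cross (close N ℕ.≤-refl)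
        w , Fy-val , adm-w = adm y Fy≢0
        qFy-val : Val q (+ q * (eval F y * e)) (suc (w ℕ.+ 0))
        qFy-val = val-* qp (val-p qp) (val-* qp Fy-val (val-unit qp q∤e))
        -- Membership in `R F` allows F x = 0; here the right side of `eq` has a valuation, which
        -- rules it out.
        v , Fx-val , adm-v = adm x (λ Fx≡0 → val⇒≢0 qp qFy-val (trans (sym eq) (cong (_* d) Fx≡0)))
        v≡ = val-unique qp (val-* qp Fx-val (val-unit qp q∤d)) (subst (λ z → Val q z (suc (w ℕ.+ 0))) (sym eq) qFy-val)
    in admissible-gap adm-v adm-w
         (trans (sym (ℕ.+-identityʳ v)) (trans v≡ (cong suc (ℕ.+-identityʳ w))))

  -- w and u stand for the denominator and numerator of the rational to approximate.
  ApproximatesFractions : ℕ → Set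
  ApproximatesFractions p = ∀ k u w → w ≢ 0ℤ → ∃[ x ] ∃[ y ] ∃[ v ]
    (Val p (w * eval F y) v × (+ p) ^ (v ℕ.+ k) ∣ u * eval F y - eval F x * w)

  -- It suffices to approximate one term `s` far enough along the Cauchy sequence: by the
  -- ultrametric inequality `small-+` the two errors add up without loss of precision.
  approximates⇒dense : ∀ {p} → Prime p → ApproximatesFractions p → DenseInℚₚ p (R F)
  approximates⇒dense {p} pp approx α k = r , (x , y , Fy≢0 , refl) , N , λ i N≤i →
      subst (∣_∣[ p ]≤p^- k) (ℚ-telescope (seq α i) s r)
        (small-+ pp {seq α i ℚ.- s} {s ℚ.- r} {k} (tail i N N≤i ℕ.≤-refl)
          (fraction-small pp (s ℚ.- r) k (‿-÷-cross s r {eval F x} {eval F y} (÷-cross {r} (eval F x) (eval F y) {{≢-nonZero Fy≢0}} refl)) vwFy close))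
    where
    N = proj₁ (cauchy α k)
    tail = proj₂ (cauchy α k)
    s = seq α N
    approximation = approx k (↥ s) (↧ s) (λ ())
    x = proj₁ approximation
    y = proj₁ (proj₂ approximation)
    vwFy = proj₁ (proj₂ (proj₂ (proj₂ approximation)))
    close = proj₂ (proj₂ (proj₂ (proj₂ approximation)))
    Fy≢0 : eval F y ≢ 0ℤ
    Fy≢0 Fy≡0 = val⇒≢0 pp vwFy (trans (cong (↧ s *_) Fy≡0) (ℤ.*-zeroʳ (↧ s)))
    r = (fromℤ (eval F x) ℚ.÷ fromℤ (eval F y)) {{≢-nonZero Fy≢0}}

-- `values` serves non-density, which concerns every value of `F`; `section` serves density, for
-- which the points (x, 1) suffice. One and several variables are thus treated alike.
record Represents {n : ℕ} (F : Poly n) (φ : ℤ → ℤ → ℤ) : Set where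
  field
    values  : ∀ v → ∃[ x ] ∃[ y ] eval F v ≡ φ x y
    section : ∀ x → ∃[ v ] eval F v ≡ φ x 1ℤ

open Represents

module _ {n : ℕ} {F : Poly n} {φ : ℤ → ℤ → ℤ} (F-φ : Represents F φ) where

  dense₂ : φ -1ℤ 1ℤ ≡ 0ℤ → Denominators (λ y → φ y 1ℤ) → Numerators (λ x → φ x 1ℤ) → DenseInℚₚ 2 (R F)
  dense₂ φ-1≡0 denominator numerator = approximates⇒dense F prime[2] λ k u w w≢0 →
    let x , y , v , w-val , close = approximate {λ z → φ z 1ℤ} φ-1≡0 denominator numerator k u w w≢0
        X , FX≡ = section F-φ x
        Y , FY≡ = section F-φ y
    in X , Y , v , subst (λ z → Val 2 (w * z) v) (sym FY≡) w-val ,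
       subst₂ (λ a b → (+ 2) ^ (v ℕ.+ k) ∣ u * a - b * w) (sym FY≡) (sym FX≡) close

  ¬dense : ∀ {q} → Prime q → (∀ x y → φ x y ≢ 0ℤ → ∃[ v ] (Val q (φ x y) v × Admissible v)) →
           ¬ DenseInℚₚ q (R F)
  ¬dense {q} qp φ-val = admissible⇒¬dense F qp λ v Fv≢0 →
    let x , y , Fv≡ = values F-φ v
        w , w-val , adm = φ-val x y (λ φ≡0 → Fv≢0 (trans Fv≡ φ≡0))
    in w , subst (λ z → Val q z w) (sym Fv≡) w-val , adm

-- Within each of the classes 15, 21, 35 the exponents are the multiples of it by
-- numbers with sum 7, 5, 3, which makes the degree divisible by 105.
factors : List LinearPower
factors = (1ℤ   X+ 1ℤ    Y^ 15)
        ∷ (+ 2  X+ 1ℤ    Y^ 90)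
        ∷ (1ℤ   X+ -1ℤ   Y^ 21)
        ∷ (1ℤ   X+ - + 2 Y^ 21)
        ∷ (1ℤ   X+ - + 4 Y^ 21)
        ∷ (+ 2  X+ -1ℤ   Y^ 42)
        ∷ (1ℤ   X+ 0ℤ    Y^ 35)
        ∷ (0ℤ   X+ 1ℤ    Y^ 70)
        ∷ []

-- Verification for the chosen factors

factors-val : ∀ {q} → Prime q → 9 < q → ∀ x y → ⟦ factors ⟧ x y ≢ 0ℤ →
              ∃[ v ] (Val q (⟦ factors ⟧ x y) v × Admissible v)
factors-val {q} qp 9<q x y = ⟦⟧-val qp {factors}
  -- The largest determinant in absolute value is 9, from 2x + y and x - 4y; none is 0.
  (AllPairs.map (λ {f} {g} (1≤∣det∣ , ∣det∣≤9) q∣det →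
      ℕ.<⇒≱ 9<q (ℕ.≤-trans (ℕ.∣⇒≤ {{ℕ.>-nonZero 1≤∣det∣}} (∣⇒∣ᵤ {+ q} {det f g} q∣det)) ∣det∣≤9))
    (from-yes (allPairs? (λ f g → (1 ℕ.≤? ℤ.∣ det f g ∣) ×-dec (ℤ.∣ det f g ∣ ℕ.≤? 9)) factors)))
  (from-yes (all? (λ f → (15 ℕ.∣? m f) ⊎-dec (21 ℕ.∣? m f) ⊎-dec (35 ℕ.∣? m f)) factors))
  (ℕ.divides 3 refl) (s≤s z≤n) {x} {y}

-- The roots 1, 2 and 4 serve the residues 0, 1 and 2 of ρ modulo 3. The constants come from the
-- remaining even factors: 15 from x + y at 1; 21 + 35 from x - 4y and x at 2; 21 + 70 from x - 2y
-- and x at 4.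
denominator : Denominators (λ y → ⟦ factors ⟧ y 1ℤ)
denominator 0 = 15 , ℕ.divides 5 refl , λ e 92≤e →
  + 1 + (+ 2) ^ e , val-near-root prime[2] {factors} L₁ L₂ (+ 1) {21} {15} {e} refl V (ℕ.≤-trans (ℕ.m≤m+n 16 76) 92≤e)
  where
  L₁ = take 2 factors
  L₂ = drop 3 factors
  -- The cofactor is computed by division; `refl` below confirms that the division is exact, and
  -- `from-no` that the quotient is odd.
  c = ⟦ L₁ ++ L₂ ⟧ (+ 1) 1ℤ ℤ./ℕ (2 ℕ.^ 15)
  V : Val 2 (⟦ L₁ ++ L₂ ⟧ (+ 1) 1ℤ) 15
  V = val c refl (from-no (+ 2 ∣? c))
denominator 1 = 56 , ℕ.divides 19 refl , λ e 92≤e →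
  + 2 + (+ 2) ^ e , val-near-root prime[2] {factors} L₁ L₂ (+ 2) {21} {56} {e} refl V (ℕ.≤-trans (ℕ.m≤m+n 57 35) 92≤e)
  where
  L₁ = take 3 factors
  L₂ = drop 4 factors
  c = ⟦ L₁ ++ L₂ ⟧ (+ 2) 1ℤ ℤ./ℕ (2 ℕ.^ 56)
  V : Val 2 (⟦ L₁ ++ L₂ ⟧ (+ 2) 1ℤ) 56
  V = val c refl (from-no (+ 2 ∣? c))
denominator 2 = 91 , ℕ.divides 31 refl , λ e 92≤e →
  + 4 + (+ 2) ^ e , val-near-root prime[2] {factors} L₁ L₂ (+ 4) {21} {91} {e} refl V 92≤e
  where
  L₁ = take 4 factors
  L₂ = drop 5 factors
  c = ⟦ L₁ ++ L₂ ⟧ (+ 4) 1ℤ ℤ./ℕ (2 ℕ.^ 91)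
  V : Val 2 (⟦ L₁ ++ L₂ ⟧ (+ 4) 1ℤ) 91
  V = val c refl (from-no (+ 2 ∣? c))
denominator (suc (suc (suc ρ))) =
  let V , 3∣ρ+V , near = denominator ρ in V , ℕ.∣m∣n⇒∣m+n (ℕ.divides 1 refl) 3∣ρ+V , near

-- Besides x + y, only x - y is even at (-1, 1), with value -2; its exponent gives 21.
numerator : Numerators (λ x → ⟦ factors ⟧ x 1ℤ)
numerator 2∤B 2∤w K i 21+K≤i =
  let n , 16^K≡ = 16^≡1+*15 K in prescribed-odd-part L 15 refl V 2∤B 2∤w K n 16^K≡ i 21+K≤i
  where
  L = drop 1 factors
  c = ⟦ L ⟧ -1ℤ 1ℤ ℤ./ℕ (2 ℕ.^ 21)
  V : Val 2 (⟦ L ⟧ -1ℤ 1ℤ) 21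
  V = val c refl (from-no (+ 2 ∣? c))

module _ {n : ℕ} {F : Poly n} (F-factors : Represents F ⟦ factors ⟧) where

  factors-dense₂ : DenseInℚₚ 2 (R F)
  factors-dense₂ = dense₂ F-factors refl denominator numerator

  factors-¬dense : ∀ q → Prime q → 9 < q → ¬ DenseInℚₚ q (R F)
  factors-¬dense q qp 9<q = ¬dense F-factors qp (factors-val qp 9<q)

-- The polynomials in one and in several variables

X₁ Y₁ : Vec ℕ 1
X₁ = 1 ∷ []
Y₁ = 0 ∷ []

X₂ Y₂ : ∀ n → Vec ℕ (2 ℕ.+ n)
X₂ n = 1 ∷ 0 ∷ Vec.replicate n 0
Y₂ n = 0 ∷ 1 ∷ Vec.replicate n 0

represents₁ : ∀ L → Represents (formAt X₁ Y₁ L) ⟦ L ⟧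
represents₁ L .values  v = monomial v X₁ , monomial v Y₁ , eval-formAt v X₁ Y₁ L
represents₁ L .section x = x ∷ [] , trans (eval-formAt (x ∷ []) X₁ Y₁ L)
  (cong (λ z → ⟦ L ⟧ z 1ℤ) (simplify x))
  where
  simplify : ∀ x → x * 1ℤ * 1ℤ ≡ x
  simplify = solve-∀

represents₂ : ∀ n L → Represents (formAt (X₂ n) (Y₂ n) L) ⟦ L ⟧
represents₂ n L .values  v = monomial v (X₂ n) , monomial v (Y₂ n) , eval-formAt v (X₂ n) (Y₂ n) L
represents₂ n L .section x = v , trans (eval-formAt v (X₂ n) (Y₂ n) L)
  (cong₂ ⟦ L ⟧ (trans (cong (λ z → x * 1ℤ * (1ℤ * z)) (monomial-0 0s)) (simplify x))
               (cong (λ z → 1ℤ * (1ℤ * z)) (monomial-0 0s)))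
  where
  -- The other variables occur with exponent 0, so setting them to 0 leaves factors 0^0 = 1.
  0s = Vec.replicate n 0ℤ
  v = x ∷ 1ℤ ∷ 0s
  simplify : ∀ x → x * 1ℤ * (1ℤ * 1ℤ) ≡ x
  simplify = solve-∀

formAt-isForm : ∀ n L → IsForm (formAt (X₂ n) (Y₂ n) L)
formAt-isForm n L = degree L , homogeneous (formAt-degree X-sum Y-sum L)
  where
  X-sum : Vec.sum (X₂ n) ≡ 1
  X-sum = cong suc (sum-replicate-0 n)
  Y-sum : Vec.sum (Y₂ n) ≡ 1
  Y-sum = cong suc (sum-replicate-0 n)

witness : ∀ {n} (F : Poly n) → Represents F ⟦ factors ⟧ → (n ≢ 1 → IsForm F) →
    Σ[ F ∈ Poly n ] Σ[ p ∈ ℕ ] Σ[ M ∈ ℕ ]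
    ((n ≢ 1 → IsForm F)
    × Prime p
    × 0 < M
    × DenseInℚₚ p (R F)
    × (∀ (q : ℕ) → Prime q → M < q → ¬ DenseInℚₚ q (R F)))
witness F F-factors form =
  F , 2 , 9 , form , prime[2] , s≤s z≤n , factors-dense₂ F-factors , factors-¬dense F-factors

theorem1p7 : ∀ (n : ℕ) → 1 ≤ n →
    Σ[ F ∈ Poly n ] Σ[ p ∈ ℕ ] Σ[ M ∈ ℕ ]
    ((n ≢ 1 → IsForm F)
    × Prime p
    × 0 < M
    × DenseInℚₚ p (R F)
    × (∀ (q : ℕ) → Prime q → M < q → ¬ DenseInℚₚ q (R F)))
theorem1p7 1             _ = witness (formAt X₁ Y₁ factors) (represents₁ factors) (λ 1≢1 → contradiction refl 1≢1)
theorem1p7 (suc (suc n)) _ = witness (formAt (X₂ n) (Y₂ n) factors) (represents₂ n factors) (λ _ → formAt-isForm n factors)
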